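{- For every integer $k\ge 1$, there are only finitely many $k$-vertex-critical $(2P_2,\overline{diamond+P_1})$-free graphs.
   Context: Graphs are finite and simple, and "finitely many" means up to isomorphism. A graph $G$ is $k$-vertex-critical if $\chi(G)=k$ and $\chi(G-v)<k$ for all $v\in V(G)$, where $\chi$ denotes the chromatic number. A graph is $(H_1,H_2)$-free if it contains no induced subgraph isomorphic to $H_1$ or $H_2$. $2P_2$ is the disjoint union of two edges. The $diamond$ is $K_4$ minus an edge, $diamond+P_1$ is its disjoint union with an isolated vertex, and $\overline{diamond+P_1}$ is the complement of that graph, i.e. the graph obtained from a triangle by attaching two leaves to a single vertex of the triangle. -}

module Defs where

open import Data.Bool using (Bool; true; false; not; _∧_; _∨_)
open import Data.Bool.Properties using (∨-comm) renaming (_≟_ to _≟ᵇ_)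
open import Data.Empty using (⊥-elim)
open import Data.Fin using (Fin; zero; suc; splitAt; punchIn; finToFun; funToFin)
open import Data.Fin.Patterns using (0F; 1F; 2F; 3F; 4F)
open import Data.Fin.Properties
  using (_≟_; any?; all?; punchIn-injective; finToFun-funToFin)
open import Data.List using (List; []; _∷_)
open import Data.List.Relation.Unary.Any using (Any)
open import Data.Nat using (ℕ; zero; suc; pred; _+_; _≤_; _<_; z≤n; s≤s)
open import Data.Product using (∃; _×_; _,_; proj₁; proj₂)
open import Data.Sum using (_⊎_; inj₁; inj₂)
open import Function using (_∘_; id)
open import Function.Bundles using (_↔_; Inverse)
open import Function.Definitions using (Injective)
open import Relation.Binary.PropositionalEquality
  using (_≡_; _≢_; refl; sym; trans; cong; cong₂; subst₂)
open import Relation.Nullary using (Dec; yes; no; ¬_; does)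
open import Relation.Nullary.Decidable using (map′; ¬?; _→-dec_; toWitness)
open import Relation.Unary using (Decidable)

record Graph (n : ℕ) : Set where
  field
    adj        : Fin n → Fin n → Bool
    adj-sym    : ∀ u v → adj u v ≡ adj v u
    adj-irrefl : ∀ v → adj v v ≡ false

open Graph public

infix 4 _≅_ _⊑_

_≅_ : ∀ {m n} → Graph m → Graph n → Set
_≅_ {m} {n} G H =
  ∃ λ (φ : Fin m ↔ Fin n) →
    ∀ u v → adj G u v ≡ adj H (Inverse.to φ u) (Inverse.to φ v)

-- H ⊑ G: the image of f is a vertex subset of G that induces a copy of H.
_⊑_ : ∀ {m n} → Graph m → Graph n → Set
_⊑_ {m} {n} H G =
  ∃ λ (f : Fin m → Fin n) →
    Injective _≡_ _≡_ f × (∀ u v → adj H u v ≡ adj G (f u) (f v))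

_,_-Free : ∀ {m₁ m₂ n} → Graph m₁ → Graph m₂ → Graph n → Set
(H₁ , H₂ -Free) G = ¬ (H₁ ⊑ G) × ¬ (H₂ ⊑ G)

infixl 6 _-_

_-_ : ∀ {n} → Graph n → Fin n → Graph (pred n)
_-_ {suc n} G x = record
  { adj        = λ u v → adj G (punchIn x u) (punchIn x v)
  ; adj-sym    = λ u v → adj-sym G (punchIn x u) (punchIn x v)
  ; adj-irrefl = λ v → adj-irrefl G (punchIn x v)
  }

Proper : ∀ {n k} → Graph n → (Fin n → Fin k) → Set
Proper G c = ∀ u v → adj G u v ≡ true → c u ≢ c v

Colourable : ∀ {n} → Graph n → ℕ → Set
Colourable {n} G k = ∃ λ (c : Fin n → Fin k) → Proper G c

Least : (ℕ → Set) → ℕ → Set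
Least P m = P m × (∀ l → P l → m ≤ l)

colourable? : ∀ {n} (G : Graph n) → Decidable (Colourable G)
colourable? G k = map′
  (λ (i , p) → finToFun i , p)
  (λ (c , p) → funToFin c , λ u v e →
    subst₂ _≢_ (sym (finToFun-funToFin c u)) (sym (finToFun-funToFin c v)) (p u v e))
  (any? λ i → all? λ u → all? λ v →
    (adj G u v ≟ᵇ true) →-dec ¬? (finToFun i u ≟ finToFun i v))

least : ∀ {P : ℕ → Set} → Decidable P → ∀ n → P n → ∃ (Least P)
least P? zero    p = zero , p , λ _ _ → z≤n
least P? (suc n) p with P? zero
... | yes p₀ = zero , p₀ , λ _ _ → z≤n
... | no ¬p₀ with least (P? ∘ suc) n p
...   | m , pm , min =
  suc m , pm , λ { zero p₀ → ⊥-elim (¬p₀ p₀) ; (suc l) pl → s≤s (min l pl) }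

n-colourable : ∀ {n} (G : Graph n) → Colourable G n
n-colourable G = id , λ { u .u e refl → true≢false (trans (sym e) (adj-irrefl G u)) }
  where
  true≢false : true ≢ false
  true≢false ()

-- Abstract, so that the exhaustive search is never unfolded; χ-least
-- determines χ uniquely.
abstract
  χ : ∀ {n} → Graph n → ℕ
  χ {n} G = proj₁ (least (colourable? G) n (n-colourable G))

  χ-least : ∀ {n} (G : Graph n) → Least (Colourable G) (χ G)
  χ-least {n} G = proj₂ (least (colourable? G) n (n-colourable G))

_-VertexCritical : ∀ {n} → ℕ → Graph n → Set
(k -VertexCritical) G = χ G ≡ k × (∀ v → χ (G - v) < k)

-- The list may contain repetitions and graphs violating P.
FinitelyMany : (∀ {n} → Graph n → Set) → Set
FinitelyMany P =
  ∃ λ (L : List (∃ Graph)) →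
    ∀ {n} (G : Graph n) → P G → Any (λ (_ , H) → G ≅ H) L

≟-sym : ∀ {n} (u v : Fin n) → does (u ≟ v) ≡ does (v ≟ u)
≟-sym u v with u ≟ v | v ≟ u
... | yes _ | yes _ = refl
... | no _  | no _  = refl
... | yes p | no ¬q = ⊥-elim (¬q (sym p))
... | no ¬p | yes q = ⊥-elim (¬p (sym q))

≟-refl : ∀ {n} (v : Fin n) → does (v ≟ v) ≡ true
≟-refl v with v ≟ v
... | yes _ = refl
... | no ¬p = ⊥-elim (¬p refl)

simple : ∀ {n} (r : Fin n → Fin n → Bool) → (∀ u v → r u v ≡ r v u) → Graph n
simple r r-sym = record
  { adj        = λ u v → not (does (u ≟ v)) ∧ r u v
  ; adj-sym    = λ u v → cong₂ (λ a b → not a ∧ b) (≟-sym u v) (r-sym u v)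
  ; adj-irrefl = λ v → cong (λ a → not a ∧ r v v) (≟-refl v)
  }

listed : ∀ {n} → List (Fin n × Fin n) → Fin n → Fin n → Bool
listed []             u v = false
listed ((a , b) ∷ es) u v = (does (u ≟ a) ∧ does (v ≟ b)) ∨ listed es u v

fromEdges : ∀ {n} → List (Fin n × Fin n) → Graph n
fromEdges es = simple (λ u v → listed es u v ∨ listed es v u)
                      (λ u v → ∨-comm (listed es u v) (listed es v u))

complement : ∀ {n} → Graph n → Graph n
complement G = simple (λ u v → not (adj G u v)) (λ u v → cong not (adj-sym G u v))

infixl 6 _⊕_

_⊕_ : ∀ {m n} → Graph m → Graph n → Graph (m + n)
_⊕_ {m} {n} G H = record
  { adj        = λ u v → a (splitAt m u) (splitAt m v)
  ; adj-sym    = λ u v → a-sym (splitAt m u) (splitAt m v)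
  ; adj-irrefl = λ v → a-irrefl (splitAt m v)
  }
  where
  a : Fin m ⊎ Fin n → Fin m ⊎ Fin n → Bool
  a (inj₁ u) (inj₁ v) = adj G u v
  a (inj₂ u) (inj₂ v) = adj H u v
  a _        _        = false

  a-sym : ∀ u v → a u v ≡ a v u
  a-sym (inj₁ u) (inj₁ v) = adj-sym G u v
  a-sym (inj₁ _) (inj₂ _) = refl
  a-sym (inj₂ _) (inj₁ _) = refl
  a-sym (inj₂ u) (inj₂ v) = adj-sym H u v

  a-irrefl : ∀ v → a v v ≡ false
  a-irrefl (inj₁ v) = adj-irrefl G v
  a-irrefl (inj₂ v) = adj-irrefl H v

P₁ : Graph 1
P₁ = fromEdges []

P₂ : Graph 2
P₂ = fromEdges ((0F , 1F) ∷ [])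

2P₂ : Graph 4
2P₂ = P₂ ⊕ P₂

-- The missing edge is 03.
diamond : Graph 4
diamond = fromEdges
  ((0F , 1F) ∷ (0F , 2F) ∷ (1F , 2F) ∷ (1F , 3F) ∷ (2F , 3F) ∷ [])

co-diamond+P₁ : Graph 5
co-diamond+P₁ = complement (diamond ⊕ P₁)

-- Triangle 0, 3, 4 with leaves 1 and 2 attached to 4.
co-diamond+P₁-edges : ∀ u v → adj co-diamond+P₁ u v ≡
  adj (fromEdges ((0F , 3F) ∷ (0F , 4F) ∷ (3F , 4F) ∷ (1F , 4F) ∷ (2F , 4F) ∷ [])) u v
co-diamond+P₁-edges = toWitness {a? = all? λ u → all? λ v → _ ≟ᵇ _} _

{-# OPTIONS --safe #-}

-- Criticality forbids N(u) ⊆ N(v) for distinct u, v. Fix a k-colouring, let s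
-- have colour j and write D(b) for the set of neighbours of b of colour j. If
-- D(b) and D(c) are incomparable, then b ~ c since G is 2P₂-free; if they
-- moreover meet, then D(c) has only one element outside D(b), for two of them
-- would be leaves at c next to a triangle on b, c and a common neighbour.
-- Choose a neighbour b of s with |D(b)| minimal. Each t in D(b) other than s
-- is missed by a neighbour c_t of s, whose D(c_t) contains D(b) \ {t}; hence b
-- and the c_t are pairwise adjacent and |D(b)| ≤ k. For the s with j and the
-- colour of b fixed, the sets D(b) are nested, so the largest contains every
-- such s; there are at most k of them. In total G has at most k³ vertices.
module Submission where

open import Defs
open import Data.Bool using (Bool; true; false; T; _∨_)
open import Data.Bool.Properties using (¬-not; ∨-comm; ∨-idem) renaming (_≟_ to _≟ᵇ_)
open import Data.Fin
  using (Fin; zero; suc; toℕ; punchIn; punchOut; finToFun; funToFin; combine)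
open import Data.Fin.Patterns using (0F; 1F; 2F; 3F; 4F)
open import Data.Fin.Properties
  using (_≟_; any?; all?; <-cmp; punchInᵢ≢i; punchIn-punchOut;
         finToFun-funToFin; combine-injective; injective⇒≤)
open import Data.Fin.Subset using (Subset; _∈_; _⊆_; ∣_∣)
open import Data.Fin.Subset.Properties using (_∈?_; p⊂q⇒∣p∣<∣q∣)
open import Data.List using (List; map; filter; allFin; upTo; concatMap)
open import Data.List.Extrema.Nat
  using (argmin; argmax; argmin-all; argmax-all; f[argmin]≤f[xs]; f[xs]≤f[argmax])
import Data.List.Membership.Propositional as List
open import Data.List.Membership.Propositional.Properties
  using (∈-filter⁺; ∈-allFin; ∈-upTo⁺; ∈-map⁺)
import Data.List.Relation.Unary.All as All
open import Data.List.Relation.Unary.All.Properties using (all-filter)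
open import Data.List.Relation.Unary.Any.Properties using (concatMap⁺)
open import Data.Nat using (ℕ; zero; suc; _^_; _*_; _≤_; _<_; _<ᵇ_; z≤n; s≤s)
open import Data.Nat.Properties using (<⇒≱; m≤n⇒m≤1+n; <⇒<ᵇ)
open import Data.Product using (∃; _×_; _,_; proj₁; proj₂)
open import Data.Sum using (_⊎_; inj₁; inj₂)
open import Data.Vec using (tabulate; lookup; _∷_; [])
open import Data.Vec.Properties using (lookup∘tabulate; lookup⇒[]=; []=⇒lookup)
open import Function using (_∘_)
open import Function.Construct.Identity using (↔-id)
open import Relation.Binary.Definitions using (tri<; tri≈; tri>)
open import Relation.Binary.PropositionalEquality
  using (_≡_; _≢_; refl; sym; trans; cong; subst)
open import Relation.Nullary using (yes; no; ¬_; does; contradiction)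
open import Relation.Nullary.Decidable
  using (¬?; _×-dec_; _⊎-dec_; _→-dec_; dec-true; dec-false; toWitness; decidable-stable)
open import Relation.Unary using (Decidable)

-- Finite search and cardinality of subsets.

true≢false : ∀ {b} → b ≡ true → b ≢ false
true≢false refl ()

module _ {n} {P : Fin n → Set} (P? : Decidable P) (f : Fin n → ℕ) where

  private
    candidates : List (Fin n)
    candidates = filter P? (allFin n)

    candidate : ∀ y → P y → y List.∈ candidates
    candidate y py = ∈-filter⁺ P? (∈-allFin y) py

  -- Abstract, since otherwise the search unfolds in the goals below.
  abstract
    minimiser : ∃ P → ∃ λ m → P m × ∀ y → P y → f m ≤ f y
    minimiser (x , px) =
      argmin f x candidates ,
      argmin-all f px (all-filter P? (allFin n)) ,
      λ y py → All.lookup (f[argmin]≤f[xs] x candidates) (candidate y py)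

    maximiser : ∃ P → ∃ λ m → P m × ∀ y → P y → f y ≤ f m
    maximiser (x , px) =
      argmax f x candidates ,
      argmax-all f px (all-filter P? (allFin n)) ,
      λ y py → All.lookup (f[xs]≤f[argmax] x candidates) (candidate y py)

module _ {n} {P : Fin n → Set} (P? : Decidable P) where

  subset : Subset n
  subset = tabulate (λ x → does (P? x))

  ∈-subset⁺ : ∀ {x} → P x → x ∈ subset
  ∈-subset⁺ {x} px = lookup⇒[]= x subset
    (trans (lookup∘tabulate _ x) (dec-true (P? x) px))

  ∈-subset⁻ : ∀ {x} → x ∈ subset → P x
  ∈-subset⁻ {x} x∈ = decidable-stable (P? x) λ ¬px → true≢false
    (trans (sym (lookup∘tabulate _ x)) ([]=⇒lookup x∈)) (dec-false (P? x) ¬px)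

-- If `q` were contained in `p`, then `x` would make the inclusion strict and `q` smaller than `p`.
∣p∣≤∣q∣⇒∃∈q∉p : ∀ {n} {p q : Subset n} {x} → ∣ p ∣ ≤ ∣ q ∣ → x ∈ p → ¬ x ∈ q →
                ∃ λ y → y ∈ q × ¬ y ∈ p
∣p∣≤∣q∣⇒∃∈q∉p {p = p} {q} {x} p≤q x∈p x∉q
  with any? (λ y → (y ∈? q) ×-dec ¬? (y ∈? p))
... | yes found = found
... | no  none  = contradiction p≤q (<⇒≱ (p⊂q⇒∣p∣<∣q∣ (q⊆p , x , x∈p , x∉q)))
  where
  q⊆p : q ⊆ p
  q⊆p {y} y∈q = decidable-stable (y ∈? p) (λ y∉p → none (y , y∈q , y∉p))

-- Recognising induced subgraphs.

module _ {m n} (H : Graph m) (G : Graph n) (f : Fin m → Fin n) where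

  -- Symmetry and irreflexivity supply the remaining pairs. On concrete vertices the `T` condition
  -- computes, so the case lists below contain only pairs in increasing order.
  adj-agrees : (∀ u v → T (toℕ u <ᵇ toℕ v) → adj H u v ≡ adj G (f u) (f v)) →
               ∀ u v → adj H u v ≡ adj G (f u) (f v)
  adj-agrees e u v with <-cmp u v
  ... | tri< u<v _ _    = e u v (<⇒<ᵇ u<v)
  ... | tri≈ _ refl _   = trans (adj-irrefl H u) (sym (adj-irrefl G (f u)))
  ... | tri> _ _ v<u    =
    trans (adj-sym H u v) (trans (e v u (<⇒<ᵇ v<u)) (adj-sym G (f v) (f u)))

  -- Reduces injectivity of an adjacency-preserving map to a finite check on `H`: only vertices with
  -- equal neighbourhoods can collide.
  identified⇒twins : (∀ u v → adj H u v ≡ adj G (f u) (f v)) →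
                     ∀ u v → f u ≡ f v → ∀ w → adj H u w ≡ adj H v w
  identified⇒twins e u v fu≡fv w =
    trans (e u w) (trans (cong (λ x → adj G x (f w)) fu≡fv) (sym (e v w)))

2P₂-twin-free : ∀ u v → (∀ w → adj 2P₂ u w ≡ adj 2P₂ v w) → u ≡ v
2P₂-twin-free = toWitness
  {a? = all? λ u → all? λ v → (all? λ w → _ ≟ᵇ _) →-dec (u ≟ v)} _

-- Only the two leaves share a neighbourhood; this is why an embedding of this graph has to be given
-- `p ≢ q`, whereas one of `2P₂` is automatically injective.
co-diamond+P₁-twins : ∀ u v → (∀ w → adj co-diamond+P₁ u w ≡ adj co-diamond+P₁ v w) →
                      u ≡ v ⊎ (u ≡ 1F × v ≡ 2F) ⊎ (u ≡ 2F × v ≡ 1F)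
co-diamond+P₁-twins = toWitness
  {a? = all? λ u → all? λ v → (all? λ w → _ ≟ᵇ _) →-dec
    ((u ≟ v) ⊎-dec (((u ≟ 1F) ×-dec (v ≟ 2F)) ⊎-dec ((u ≟ 2F) ×-dec (v ≟ 1F))))} _

module _ {n} (G : Graph n) where

  swap : ∀ {u v b} → adj G u v ≡ b → adj G v u ≡ b
  swap {u} {v} = trans (adj-sym G v u)

  2P₂-⊑ : ∀ {a b c d} → adj G a b ≡ true → adj G c d ≡ true →
          adj G a c ≡ false → adj G a d ≡ false →
          adj G b c ≡ false → adj G b d ≡ false → 2P₂ ⊑ G
  2P₂-⊑ {a} {b} {c} {d} ab cd ac ad bc bd =
    f , (λ {u} {v} → 2P₂-twin-free u v ∘ identified⇒twins 2P₂ G f agrees u v) , agrees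
    where
    f : Fin 4 → Fin n
    f = lookup (a ∷ b ∷ c ∷ d ∷ [])

    agrees : ∀ u v → adj 2P₂ u v ≡ adj G (f u) (f v)
    agrees = adj-agrees 2P₂ G f λ where
      0F 1F _ → sym ab
      0F 2F _ → sym ac
      0F 3F _ → sym ad
      1F 2F _ → sym bc
      1F 3F _ → sym bd
      2F 3F _ → sym cd

  co-diamond+P₁-⊑ : ∀ {a p q b c} → p ≢ q →
    adj G a b ≡ true → adj G a c ≡ true → adj G b c ≡ true →
    adj G p c ≡ true → adj G q c ≡ true → adj G p q ≡ false →
    adj G a p ≡ false → adj G a q ≡ false →
    adj G p b ≡ false → adj G q b ≡ false → co-diamond+P₁ ⊑ G
  co-diamond+P₁-⊑ {a} {p} {q} {b} {c} p≢q ab ac bc pc qc pq ap aq pb qb =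
    f , injective , agrees
    where
    f : Fin 5 → Fin n
    f = lookup (a ∷ p ∷ q ∷ b ∷ c ∷ [])

    agrees : ∀ u v → adj co-diamond+P₁ u v ≡ adj G (f u) (f v)
    agrees = adj-agrees co-diamond+P₁ G f λ where
      0F 1F _ → sym ap
      0F 2F _ → sym aq
      0F 3F _ → sym ab
      0F 4F _ → sym ac
      1F 2F _ → sym pq
      1F 3F _ → sym pb
      1F 4F _ → sym pc
      2F 3F _ → sym qb
      2F 4F _ → sym qc
      3F 4F _ → sym bc

    injective : ∀ {u v} → f u ≡ f v → u ≡ v
    injective {u} {v} fu≡fv
      with co-diamond+P₁-twins u v (identified⇒twins co-diamond+P₁ G f agrees u v fu≡fv)
    ... | inj₁ u≡v                  = u≡v
    ... | inj₂ (inj₁ (refl , refl)) = contradiction fu≡fv p≢q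
    ... | inj₂ (inj₂ (refl , refl)) = contradiction (sym fu≡fv) p≢q

  Incomparable : Set
  Incomparable = ∀ u v → u ≢ v → ∃ λ w → adj G u w ≡ true × adj G v w ≡ false

-- Criticality and incomparable neighbourhoods.

colourable-extend : ∀ {n l} (G : Graph (suc n)) {u v : Fin (suc n)} → u ≢ v →
                    (∀ w → adj G u w ≡ true → adj G v w ≡ true) →
                    Colourable (G - u) l → Colourable G l
colourable-extend {l = l} G {u} {v} u≢v N⊆ (c , proper) = c′ , proper′
  where
  -- The vertex `u` receives the colour of `v`; every neighbour of `u` is also one of `v`, so no
  -- conflict arises.
  c′ : Fin _ → Fin l
  c′ w with u ≟ w
  ... | yes _   = c (punchOut u≢v)
  ... | no  u≢w = c (punchOut u≢w)

  proper-punchOut : ∀ {x y} (u≢x : u ≢ x) (u≢y : u ≢ y) → adj G x y ≡ true →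
                    c (punchOut u≢x) ≢ c (punchOut u≢y)
  proper-punchOut u≢x u≢y xy = proper _ _
    (subst (λ x → adj G x _ ≡ true) (sym (punchIn-punchOut u≢x))
      (subst (λ y → adj G _ y ≡ true) (sym (punchIn-punchOut u≢y)) xy))

  proper′ : Proper G c′
  proper′ x y xy with u ≟ x | u ≟ y
  ... | yes refl | yes refl = contradiction (adj-irrefl G x) (true≢false xy)
  ... | yes refl | no  u≢y  = proper-punchOut u≢v u≢y (N⊆ y xy)
  ... | no  u≢x  | yes refl =
    proper-punchOut u≢x u≢v (swap G (N⊆ x (swap G xy)))
  ... | no  u≢x  | no  u≢y  = proper-punchOut u≢x u≢y xy

critical⇒incomparable : ∀ {n k} (G : Graph n) → (k -VertexCritical) G → Incomparable G
critical⇒incomparable {suc n} G (χ≡k , χ<k) u v u≢v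
  with any? (λ w → (adj G u w ≟ᵇ true) ×-dec (adj G v w ≟ᵇ false))
... | yes found = found
... | no  none  = contradiction
  (proj₂ (χ-least G) _ (colourable-extend G u≢v N⊆ (proj₁ (χ-least (G - u)))))
  (<⇒≱ (subst (χ (G - u) <_) (sym χ≡k) (χ<k u)))
  where
  N⊆ : ∀ w → adj G u w ≡ true → adj G v w ≡ true
  N⊆ w uw = ¬-not (λ vw → none (w , uw , vw))

-- Neighbourhoods within one colour class.

module _ {n k} (G : Graph n) (free : (2P₂ , co-diamond+P₁ -Free) G)
         (inc : Incomparable G) (col : Fin n → Fin k) (proper : Proper G col) where

  same-colour⇒non-adjacent : ∀ {u v j} → col u ≡ j → col v ≡ j → adj G u v ≡ false
  same-colour⇒non-adjacent {u} {v} cu cv =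
    ¬-not (λ uv → proper u v uv (trans cu (sym cv)))

  InD? : ∀ j b → Decidable (λ v → adj G b v ≡ true × col v ≡ j)
  InD? j b v = (adj G b v ≟ᵇ true) ×-dec (col v ≟ j)

  size : Fin k → Fin n → ℕ
  size j b = ∣ subset (InD? j b) ∣

  -- Turns a comparison of sizes into incomparability: if D(c) is no smaller than D(b) but misses
  -- some `x` in it, then it has a `y` outside D(b).
  escape : ∀ {j b c x} → size j b ≤ size j c →
           adj G b x ≡ true → col x ≡ j → adj G c x ≡ false →
           ∃ λ y → adj G c y ≡ true × col y ≡ j × adj G b y ≡ false
  escape {j} {b} {c} b≤c bx xj cx
    with ∣p∣≤∣q∣⇒∃∈q∉p b≤c (∈-subset⁺ (InD? j b) (bx , xj))
           (λ x∈ → true≢false (proj₁ (∈-subset⁻ (InD? j c) x∈)) cx)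
  ... | y , y∈ , y∉ with ∈-subset⁻ (InD? j c) y∈
  ...   | cy , yj = y , cy , yj , ¬-not (λ by → y∉ (∈-subset⁺ (InD? j b) (by , yj)))

  -- Otherwise the edges `b x` and `c y` would induce `2P₂`, since `x` and `y` share a colour.
  incomparable⇒adjacent : ∀ {j b c x y} → col x ≡ j → col y ≡ j →
    adj G b x ≡ true → adj G c x ≡ false →
    adj G c y ≡ true → adj G b y ≡ false → adj G b c ≡ true
  incomparable⇒adjacent xj yj bx cx cy by = ¬-not λ bc → proj₁ free
    (2P₂-⊑ G bx cy bc by (swap G cx) (same-colour⇒non-adjacent xj yj))

  -- The witnesses `x` and `y` give the edge `b c`, so `s`, `b`, `c` form a triangle; distinct `y`
  -- and `y′` would be leaves attached to it at `c`.
  excess-unique : ∀ {j b c s x y y′} →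
    col s ≡ j → col x ≡ j → col y ≡ j → col y′ ≡ j →
    adj G b s ≡ true → adj G c s ≡ true →
    adj G b x ≡ true → adj G c x ≡ false →
    adj G c y ≡ true → adj G b y ≡ false →
    adj G c y′ ≡ true → adj G b y′ ≡ false → y ≡ y′
  excess-unique {y = y} {y′} sj xj yj y′j bs cs bx cx cy by cy′ by′ =
    decidable-stable (y ≟ y′) λ y≢y′ → proj₂ free
      (co-diamond+P₁-⊑ G y≢y′ (swap G bs) (swap G cs)
        (incomparable⇒adjacent xj yj bx cx cy by)
        (swap G cy) (swap G cy′) (same-colour⇒non-adjacent yj y′j)
        (same-colour⇒non-adjacent sj yj) (same-colour⇒non-adjacent sj y′j)
        (swap G by) (swap G by′))

  InjectiveOnD : Fin k → Fin n → (Fin n → Fin k) → Set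
  InjectiveOnD j b φ = ∀ {t t′} → adj G b t ≡ true → col t ≡ j →
    adj G b t′ ≡ true → col t′ ≡ j → φ t ≡ φ t′ → t ≡ t′

  -- Colouring a smallest neighbourhood injectively.

  module _ (s b : Fin n) (sb : adj G s b ≡ true)
           (minimal : ∀ c → adj G s c ≡ true → size (col s) b ≤ size (col s) c) where

    -- By minimality of `b`, a `c` that misses `t` has a private neighbour `y`; now `excess-unique`
    -- applies with `b` and `c` exchanged.
    miss-unique : ∀ {c t t′} → adj G s c ≡ true →
      adj G b t ≡ true → col t ≡ col s → adj G c t ≡ false →
      adj G b t′ ≡ true → col t′ ≡ col s → adj G c t′ ≡ false → t ≡ t′
    miss-unique sc bt tj ct bt′ t′j ct′ with escape (minimal _ sc) bt tj ct
    ... | y , cy , yj , by =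
      excess-unique refl yj tj t′j (swap G sc) (swap G sb) cy by bt ct bt′ ct′

    miss⇒adjacent : ∀ {c t} → adj G s c ≡ true →
      adj G b t ≡ true → col t ≡ col s → adj G t c ≡ false → adj G b c ≡ true
    miss⇒adjacent sc bt tj tc with escape (minimal _ sc) bt tj (swap G tc)
    ... | y , cy , yj , by = incomparable⇒adjacent tj yj bt (swap G tc) cy by

    -- A `t` other than `s` gets the colour of some neighbour of `s` that misses it. No neighbour of
    -- `s` misses `s` itself, so `s` gets the colour of `b`.
    palette : Fin n → Fin k
    palette t with s ≟ t
    ... | yes _   = col b
    ... | no  s≢t = col (proj₁ (inc s t s≢t))

    palette-injective : InjectiveOnD (col s) b palette
    palette-injective {t} {t′} bt tj bt′ t′j eq with s ≟ t | s ≟ t′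
    ... | yes refl | yes refl = refl
    ... | yes refl | no  s≢t′ =
      let c′ , sc′ , t′c′ = inc s t′ s≢t′
      in contradiction eq (proper b c′ (miss⇒adjacent sc′ bt′ t′j t′c′))
    ... | no  s≢t  | yes refl =
      let c , sc , tc = inc s t s≢t
      in contradiction (sym eq) (proper b c (miss⇒adjacent sc bt tj tc))
    ... | no  s≢t  | no  s≢t′ with inc s t s≢t | inc s t′ s≢t′
    -- If `t` and `t′` differ, then by `miss-unique` `c` sees `t′` and `c′` sees `t`. So D(c) and
    -- D(c′) are incomparable, and `c`, `c′` are adjacent with different colours.
    ...   | c , sc , tc | c′ , sc′ , t′c′ = decidable-stable (t ≟ t′) λ t≢t′ →
      proper c c′
        (incomparable⇒adjacent t′j tj
          (¬-not λ ct′ → t≢t′ (miss-unique sc bt tj (swap G tc) bt′ t′j ct′))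
          (swap G t′c′)
          (¬-not λ c′t → t≢t′ (miss-unique sc′ bt tj c′t bt′ t′j (swap G t′c′)))
          (swap G tc))
        eq

  -- Nested neighbourhoods and the cubic bound.

  module _ (neighbour : ∀ s → ∃ λ b → adj G s b ≡ true) where

    smallest : ∀ s → ∃ λ b → adj G s b ≡ true ×
               ∀ c → adj G s c ≡ true → size (col s) b ≤ size (col s) c
    smallest s = minimiser (λ b → adj G s b ≟ᵇ true) (size (col s)) (neighbour s)

    anchor : Fin n → Fin n
    anchor s = proj₁ (smallest s)

    s~anchor : ∀ s → adj G s (anchor s) ≡ true
    s~anchor s = proj₁ (proj₂ (smallest s))

    anchor-palette : ∀ {j} s → col s ≡ j → ∃ (InjectiveOnD j (anchor s))
    anchor-palette s refl = palette s (anchor s) (s~anchor s) minimal ,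
                            palette-injective s (anchor s) (s~anchor s) minimal
      where
      minimal = proj₂ (proj₂ (smallest s))

    -- Incomparable sets would make `b` and `c` adjacent, which their common colour forbids.
    nested : ∀ {j b c x} → col b ≡ col c → size j b ≤ size j c →
             adj G b x ≡ true → col x ≡ j → adj G c x ≡ true
    nested {b = b} {c} b≡c b≤c bx xj = ¬-not λ cx →
      let y , cy , yj , by = escape b≤c bx xj cx
      in proper b c (incomparable⇒adjacent xj yj bx cx cy by) b≡c

    InCell : Fin k → Fin k → Fin n → Set
    InCell j i s = col s ≡ j × col (anchor s) ≡ i

    InCell? : ∀ j i → Decidable (InCell j i)
    InCell? j i s = (col s ≟ j) ×-dec (col (anchor s) ≟ i)

    -- Each `u` of the cell lies in D(`anchor u`). The anchors share the colour `i`, so these sets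
    -- are nested and the largest contains the cell; the palette there is injective.
    cell-palette : ∀ j i → ∃ λ (φ : Fin n → Fin k) →
      ∀ {u v} → InCell j i u → InCell j i v → φ u ≡ φ v → u ≡ v
    cell-palette j i with any? (InCell? j i)
    -- An arbitrary map serves for an empty cell.
    ... | no  empty = col , λ u∈ _ _ → contradiction (_ , u∈) empty
    ... | yes inhabited
      with maximiser (InCell? j i) (λ s → size j (anchor s)) inhabited
    ...   | m , (mj , mi) , max with anchor-palette m mj
    ...     | φ , inj = φ , λ u∈ v∈ →
      inj (in-D u∈) (proj₁ u∈) (in-D v∈) (proj₁ v∈)
      where
      in-D : ∀ {u} → InCell j i u → adj G (anchor m) u ≡ true
      in-D {u} u∈@(uj , ui) =
        nested (trans ui (sym mi)) (max u u∈) (swap G (s~anchor u)) uj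

    order≤k³ : n ≤ k * k * k
    order≤k³ = injective⇒≤ {f = code} λ {u} {v} → code-injective u v
      where
      φ : Fin n → Fin k
      φ u = proj₁ (cell-palette (col u) (col (anchor u))) u

      code : Fin n → Fin (k * k * k)
      code u = combine (combine (col u) (col (anchor u))) (φ u)

      φ-injective : ∀ {j i u v} → InCell j i u → InCell j i v → φ u ≡ φ v → u ≡ v
      φ-injective {j} {i} u∈@(refl , refl) v∈ eq =
        proj₂ (cell-palette j i) u∈ v∈ (trans eq (φ-in v∈))
        where
        -- `φ v` consults the palette of the cell of `v`; this identifies it with the palette of the
        -- fixed cell, so that the two values can be compared.
        φ-in : ∀ {v} → InCell j i v → φ v ≡ proj₁ (cell-palette j i) v
        φ-in (vj , vi) rewrite vj | vi = refl

      code-injective : ∀ u v → code u ≡ code v → u ≡ v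
      code-injective u v eq
        with combine-injective (combine (col u) (col (anchor u))) (φ u) _ (φ v) eq
      ... | eq₁₂ , eq₃ with combine-injective (col u) (col (anchor u)) _ _ eq₁₂
      ...   | eq₁ , eq₂ = φ-injective (refl , refl) (sym eq₁ , sym eq₂) eq₃

-- The successor absorbs the one-vertex graph, where there is no second vertex from which
-- incomparability could produce a neighbour.
critical-order-bound : ∀ {n k} (G : Graph n) → (k -VertexCritical) G →
                       (2P₂ , co-diamond+P₁ -Free) G → n ≤ suc (k * k * k)
critical-order-bound {zero}        G critical free = z≤n
critical-order-bound {suc zero}    G critical free = s≤s z≤n
critical-order-bound {suc (suc n)} G critical free
  with subst (Colourable G) (proj₁ critical) (proj₁ (χ-least G))
... | col , proper = m≤n⇒m≤1+n (order≤k³ G free inc col proper neighbour)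
  where
  inc : Incomparable G
  inc = critical⇒incomparable G critical

  neighbour : ∀ s → ∃ λ b → adj G s b ≡ true
  neighbour s with inc s (punchIn s zero) (punchInᵢ≢i s zero ∘ sym)
  ... | b , sb , _ = b , sb

-- Listing all graphs of bounded order.

toFin₂ : Bool → Fin 2
toFin₂ false = 0F
toFin₂ true  = 1F

toFin₂-≟1 : ∀ b → does (toFin₂ b ≟ 1F) ≡ b
toFin₂-≟1 false = refl
toFin₂-≟1 true  = refl

module _ {n : ℕ} where

  entry : Fin ((2 ^ n) ^ n) → Fin n → Fin n → Bool
  entry i u v = does (finToFun (finToFun i u) v ≟ 1F)

  -- A code is an arbitrary 0-1 matrix; the disjunction symmetrises it and `simple` clears the
  -- diagonal, so every code yields a graph.
  decode : Fin ((2 ^ n) ^ n) → Graph n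
  decode i = simple (λ u v → entry i u v ∨ entry i v u)
                    (λ u v → ∨-comm (entry i u v) (entry i v u))

  encode : Graph n → Fin ((2 ^ n) ^ n)
  encode G = funToFin λ u → funToFin λ v → toFin₂ (adj G u v)

  entry-encode : ∀ G u v → entry (encode G) u v ≡ adj G u v
  entry-encode G u v
    rewrite finToFun-funToFin (λ u → funToFin λ v → toFin₂ (adj G u v)) u
          | finToFun-funToFin (λ v → toFin₂ (adj G u v)) v
    = toFin₂-≟1 (adj G u v)

  decode-encode : ∀ G u v → adj G u v ≡ adj (decode (encode G)) u v
  decode-encode G u v with u ≟ v
  ... | yes refl = adj-irrefl G u
  ... | no  _ rewrite entry-encode G u v | entry-encode G v u | adj-sym G v u
    = sym (∨-idem (adj G u v))

bounded⇒finitelyMany : ∀ {P : ∀ {n} → Graph n → Set} N →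
                       (∀ {n} (G : Graph n) → P G → n ≤ N) → FinitelyMany P
-- `upTo` excludes its argument, hence `suc N`. Every labelled graph is listed, so the identity
-- serves as isomorphism.
bounded⇒finitelyMany N bound = concatMap graphs (upTo (suc N)) , λ {n} G p →
  concatMap⁺ graphs (List.lose (∈-upTo⁺ (s≤s (bound G p)))
    (List.lose (∈-map⁺ (λ i → n , decode i) (∈-allFin (encode G)))
      (↔-id (Fin n) , decode-encode G)))
  where
  graphs : ℕ → List (∃ Graph)
  graphs n = map (λ i → n , decode i) (allFin ((2 ^ n) ^ n))

corollary5p3 : ∀ (k : ℕ) → 1 ≤ k →
    FinitelyMany (λ G → (k -VertexCritical) G × (2P₂ , co-diamond+P₁ -Free) G)
corollary5p3 k _ = bounded⇒finitelyMany (suc (k * k * k))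
  λ G (critical , free) → critical-order-bound G critical free
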